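{- For a countable $L$-structure $\mathbb X$ the following are equivalent: (a) $\mathbb X$ is weakly reversible; (b) for every countable $L$-structure $\mathbb Y$, $\mathbb X\equiv_{\mathcal P_{\infty\omega}}\mathbb Y$ implies $\mathbb Y\cong\mathbb X$; (c) the theory $\mathrm{Th}_{\mathcal P_{\infty\omega}\cup\mathcal N_{\infty\omega}}(\mathbb X)$ of all sentences of $\mathcal P_{\infty\omega}\cup\mathcal N_{\infty\omega}$ true in $\mathbb X$ is $\omega$-categorical, i.e. every countable $L$-structure satisfying all these sentences is isomorphic to $\mathbb X$.
   Context: $L=\langle R_i:i\in I\rangle$ is a relational language, $R_i$ of arity $n_i$. A condensation from $\mathbb X$ onto $\mathbb Y$ is a bijection $F:X\to Y$ such that for all $i\in I$ and $\bar x\in X^{n_i}$, $\bar x\in R_i^{\mathbb X}$ implies $F\bar x\in R_i^{\mathbb Y}$ (where $F\bar x$ is coordinatewise). $\mathbb X\sim_c\mathbb Y$ means there are condensations from $\mathbb X$ onto $\mathbb Y$ and from $\mathbb Y$ onto $\mathbb X$. $\mathbb X$ is weakly reversible iff for every $L$-structure $\mathbb Y$, $\mathbb Y\sim_c\mathbb X$ implies $\mathbb Y\cong\mathbb X$. Formula classes: $\mathcal P_0$ consists of all atomic formulas ($v_\alpha=v_\beta$, $R_i(v_{\alpha_1},\dots,v_{\alpha_{n_i}})$) and all $\neg\,v_\alpha=v_\beta$. $\mathcal N_0$ consists of all $\neg R_i(v_{\alpha_1},\dots,v_{\alpha_{n_i}})$, all $v_\alpha=v_\beta$ and all $\neg\,v_\alpha=v_\beta$.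 $\mathcal P_{\infty\omega}$ (resp. $\mathcal N_{\infty\omega}$) is the closure of $\mathcal P_0$ (resp. $\mathcal N_0$) under $\forall v$, $\exists v$ and conjunctions and disjunctions of arbitrary sets of formulas (no negation). For a class $\mathcal F$ of formulas, $\mathbb X\equiv_{\mathcal F}\mathbb Y$ means $\mathbb X$ and $\mathbb Y$ satisfy the same sentences of $\mathcal F$. -}

module Defs where

open import Data.Fin.Base using (Fin)
open import Data.Nat.Base using (ℕ; zero; suc)
open import Data.Product.Base using (Σ; _×_)
open import Data.Vec.Base using (Vec; []; _∷_; lookup; map)
open import Function.Bundles using (_⤖_; _↣_; _⇔_; module Bijection)
open import Level using (Level) renaming (suc to lsuc)
open import Relation.Binary.PropositionalEquality.Core using (_≡_)
open import Relation.Nullary.Negation.Core using (¬_)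
open import Relation.Unary using (Pred; _∈_)

private
  variable
    ℓ p : Level

record Language (ℓ : Level) : Set (lsuc ℓ) where
  field
    Symbol : Set ℓ
    arity  : Symbol → ℕ

open Language public

-- Carriers may be empty and arities may be 0.
record Structure {ℓ} (L : Language ℓ) : Set (lsuc ℓ) where
  field
    Carrier : Set ℓ
    Rel     : (i : Symbol L) → Vec Carrier (arity L i) → Set ℓ

open Structure public

private
  variable
    L : Language ℓ
    n : ℕ

-- "Countable" means finite or countably infinite.
Countable : Structure {ℓ} L → Set ℓ
Countable X = Carrier X ↣ ℕ

------------------------------------------------------------------------
-- Condensations, isomorphisms, weak reversibility

record Condensation {L : Language ℓ} (X Y : Structure L) : Set ℓ where
  field
    bijection : Carrier X ⤖ Carrier Y
    preserves : ∀ i (xs : Vec (Carrier X) (arity L i)) →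
                Rel X i xs → Rel Y i (map (Bijection.to bijection) xs)

infix 4 _∼c_ _≅_

_∼c_ : (X Y : Structure {ℓ} L) → Set ℓ
X ∼c Y = Condensation X Y × Condensation Y X

record _≅_ {L : Language ℓ} (X Y : Structure L) : Set ℓ where
  field
    bijection : Carrier X ⤖ Carrier Y
    preserves : ∀ i (xs : Vec (Carrier X) (arity L i)) →
                Rel X i xs ⇔ Rel Y i (map (Bijection.to bijection) xs)

WeaklyReversible : Structure {ℓ} L → Set (lsuc ℓ)
WeaklyReversible {L = L} X = (Y : Structure L) → Y ∼c X → Y ≅ X

------------------------------------------------------------------------
-- The infinitary logic L∞ω

-- Formula L n contains the formulas whose free variables are among n
-- variables; bound variables are de Bruijn indices.  Every subformula of
-- an L∞ω-sentence lies in the scope of only finitely many quantifiers,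
-- hence has finitely many free variables, so up to renaming of bound
-- variables nothing is lost at the level of sentences.  A set of
-- formulas is given as a family indexed by an arbitrary A : Set ℓ.
data Formula {ℓ} (L : Language ℓ) (n : ℕ) : Set (lsuc ℓ) where
  _≐_   : (α β : Fin n) → Formula L n
  rel   : (i : Symbol L) → Vec (Fin n) (arity L i) → Formula L n
  ¬̇_    : Formula L n → Formula L n
  ∀̇_ ∃̇_ : Formula L (suc n) → Formula L n
  ⋀ ⋁   : (A : Set ℓ) → (A → Formula L n) → Formula L n

infix  7 _≐_
infixr 6 ¬̇_ ∀̇_ ∃̇_

Sentence : Language ℓ → Set (lsuc ℓ)
Sentence L = Formula L 0

Sat : (X : Structure {ℓ} L) → Vec (Carrier X) n → Formula L n → Set ℓ
Sat X ρ (α ≐ β)    = lookup ρ α ≡ lookup ρ β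
Sat X ρ (rel i αs) = Rel X i (map (lookup ρ) αs)
Sat X ρ (¬̇ φ)      = ¬ Sat X ρ φ
Sat X ρ (∀̇ φ)      = (x : Carrier X) → Sat X (x ∷ ρ) φ
Sat X ρ (∃̇ φ)      = Σ (Carrier X) λ x → Sat X (x ∷ ρ) φ
Sat X ρ (⋀ A φ)    = (a : A) → Sat X ρ (φ a)
Sat X ρ (⋁ A φ)    = Σ A λ a → Sat X ρ (φ a)

infix 4 _⊨_

_⊨_ : Structure {ℓ} L → Sentence L → Set ℓ
X ⊨ φ = Sat X [] φ

data 𝓟₀ {L : Language ℓ} {n} : Pred (Formula L n) ℓ where
  eq  : ∀ α β  → 𝓟₀ (α ≐ β)
  neq : ∀ α β  → 𝓟₀ (¬̇ (α ≐ β))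
  rel : ∀ i αs → 𝓟₀ (rel i αs)

data 𝓝₀ {L : Language ℓ} {n} : Pred (Formula L n) ℓ where
  eq   : ∀ α β  → 𝓝₀ (α ≐ β)
  neq  : ∀ α β  → 𝓝₀ (¬̇ (α ≐ β))
  nrel : ∀ i αs → 𝓝₀ (¬̇ (rel i αs))

data Closure {L : Language ℓ} (𝓑 : ∀ {n} → Pred (Formula L n) ℓ) :
             ∀ {n} → Pred (Formula L n) (lsuc ℓ) where
  base : {φ : Formula L n} → 𝓑 φ → Closure 𝓑 φ
  all  : {φ : Formula L (suc n)} → Closure 𝓑 φ → Closure 𝓑 (∀̇ φ)
  ex   : {φ : Formula L (suc n)} → Closure 𝓑 φ → Closure 𝓑 (∃̇ φ)
  conj : {A : Set ℓ} {φ : A → Formula L n} →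
         (∀ a → Closure 𝓑 (φ a)) → Closure 𝓑 (⋀ A φ)
  disj : {A : Set ℓ} {φ : A → Formula L n} →
         (∀ a → Closure 𝓑 (φ a)) → Closure 𝓑 (⋁ A φ)

𝓟∞ω 𝓝∞ω : {L : Language ℓ} → Pred (Formula L n) (lsuc ℓ)
𝓟∞ω = Closure 𝓟₀
𝓝∞ω = Closure 𝓝₀

------------------------------------------------------------------------
-- Elementary equivalence and theories relative to a class of sentences

infix 4 _≡[_]_

_≡[_]_ : Structure {ℓ} L → Pred (Sentence L) p → Structure L → Set _
X ≡[ 𝓕 ] Y = ∀ φ → φ ∈ 𝓕 → (X ⊨ φ) ⇔ (Y ⊨ φ)

Th : Pred (Sentence {ℓ} L) p → Structure L → Pred (Sentence L) _
Th 𝓕 X φ = φ ∈ 𝓕 × (X ⊨ φ)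

infix 4 _⊨ᵀ_

_⊨ᵀ_ : Structure {ℓ} L → Pred (Sentence L) p → Set _
X ⊨ᵀ T = ∀ φ → φ ∈ T → X ⊨ φ

-- ω-categoricity of a theory T, intended for T with countable model X.
ω-CategoricalAt : Structure {ℓ} L → Pred (Sentence L) p → Set _
ω-CategoricalAt {L = L} X T =
  (Y : Structure L) → Countable Y → Y ⊨ᵀ T → Y ≅ X

{-# OPTIONS --safe #-}
-- On countable structures, X ≡[ 𝓟∞ω ] Y is the same as X ∼c Y.  A condensation
-- preserves 𝓟∞ω.  Conversely, play the back-and-forth game in which Spoiler must
-- exhibit a failure of the map x̄ ↦ ȳ to be injective, well defined or
-- relation-preserving.  A winning strategy of Spoiler is a well-founded tree, and
-- recursion on it yields a 𝓟∞ω-formula true of x̄ and false of ȳ; without one, a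
-- run of the game along enumerations of X and Y builds a condensation.  Part (c)
-- reduces to (b) because dualisation exchanges 𝓟∞ω and 𝓝∞ω.
module Submission where

open import Level using (Level)
open import Axiom.ExcludedMiddle using (ExcludedMiddle)
open import Data.Empty using (⊥-elim)
open import Data.Fin.Base using (Fin; zero; suc)
open import Data.Nat.Base using (ℕ; zero; suc; _≤_; _⊔_; _≤′_; ≤′-refl; ≤′-step)
open import Data.Nat.Properties using (≤⇒≤′; m≤m⊔n; m≤n⊔m)
open import Data.Product.Base using (Σ; ∃; _×_; _,_; proj₁; proj₂)
open import Data.Sum.Base using (inj₁; inj₂)
open import Data.Vec.Base using (Vec; []; _∷_; lookup; map)
open import Data.Vec.Properties using (lookup-map; map-∘; map-cong)
open import Data.Vec.Relation.Unary.All as All using (All; []; _∷_)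
open import Function.Base using (_∘_; id)
open import Function.Bundles
  using (_⇔_; _⤖_; _↣_; mk⇔; mk⤖; module Bijection; module Equivalence; module Injection)
open import Function.Construct.Composition using (_↣-∘_)
open import Relation.Binary.PropositionalEquality
  using (_≡_; _≢_; refl; sym; trans; cong; cong₂; subst)
open import Relation.Nullary using (¬_; yes; no)
open import Relation.Nullary.Decidable using (decidable-stable)
open import Relation.Unary using (_∈_; _∪_)
open import Defs

private
  variable
    ℓ : Level
    n : ℕ
    L : Language ℓ

¬∀⇒∃¬ : ExcludedMiddle ℓ → {A : Set ℓ} {P : A → Set ℓ} → ¬ (∀ a → P a) → Σ A λ a → ¬ P a
¬∀⇒∃¬ em ¬∀ = decidable-stable em λ ¬∃ → ¬∀ λ a → decidable-stable em λ ¬p → ¬∃ (a , ¬p)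

-- Duality

-- Negation pushed down to the atoms. In `𝓟∞ω` and `𝓝∞ω` only atoms are negated, so dropping the
-- sign in the `¬̇` case suffices to land in the other class.
dual : Formula L n → Formula L n
dual (α ≐ β)    = ¬̇ (α ≐ β)
dual (rel i αs) = ¬̇ (rel i αs)
dual (¬̇ φ)      = φ
dual (∀̇ φ)      = ∃̇ dual φ
dual (∃̇ φ)      = ∀̇ dual φ
dual (⋀ A φ)    = ⋁ A (dual ∘ φ)
dual (⋁ A φ)    = ⋀ A (dual ∘ φ)

dual-𝓟 : {φ : Formula L n} → φ ∈ 𝓟∞ω → dual φ ∈ 𝓝∞ω
dual-𝓟 (base (eq α β))   = base (neq α β)
dual-𝓟 (base (neq α β))  = base (eq α β)
dual-𝓟 (base (rel i αs)) = base (nrel i αs)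
dual-𝓟 (all p)           = ex (dual-𝓟 p)
dual-𝓟 (ex p)            = all (dual-𝓟 p)
dual-𝓟 (conj p)          = disj (dual-𝓟 ∘ p)
dual-𝓟 (disj p)          = conj (dual-𝓟 ∘ p)

dual-𝓝 : {φ : Formula L n} → φ ∈ 𝓝∞ω → dual φ ∈ 𝓟∞ω
dual-𝓝 (base (eq α β))    = base (neq α β)
dual-𝓝 (base (neq α β))   = base (eq α β)
dual-𝓝 (base (nrel i αs)) = base (rel i αs)
dual-𝓝 (all p)            = ex (dual-𝓝 p)
dual-𝓝 (ex p)             = all (dual-𝓝 p)
dual-𝓝 (conj p)           = disj (dual-𝓝 ∘ p)
dual-𝓝 (disj p)           = conj (dual-𝓝 ∘ p)

module _ {L : Language ℓ} (X : Structure L) where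

  dual-sound : (φ : Formula L n) {ρ : Vec (Carrier X) n} → Sat X ρ (dual φ) → ¬ Sat X ρ φ
  dual-sound (α ≐ β)    s       t       = s t
  dual-sound (rel i αs) s       t       = s t
  dual-sound (¬̇ φ)      s       t       = t s
  dual-sound (∀̇ φ)      (x , s) t       = dual-sound φ s (t x)
  dual-sound (∃̇ φ)      s       (x , t) = dual-sound φ (s x) t
  dual-sound (⋀ A φ)    (a , s) t       = dual-sound (φ a) s (t a)
  dual-sound (⋁ A φ)    s       (a , t) = dual-sound (φ a) (s a) t

  dual-complete : ExcludedMiddle ℓ → (φ : Formula L n) {ρ : Vec (Carrier X) n} →
                  ¬ Sat X ρ φ → Sat X ρ (dual φ)
  dual-complete em (α ≐ β)    ¬s = ¬s
  dual-complete em (rel i αs) ¬s = ¬s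
  dual-complete em (¬̇ φ)      ¬s = decidable-stable em ¬s
  dual-complete em (∀̇ φ)      ¬s = let x , ¬t = ¬∀⇒∃¬ em ¬s in x , dual-complete em φ ¬t
  dual-complete em (∃̇ φ)      ¬s = λ x → dual-complete em φ λ t → ¬s (x , t)
  dual-complete em (⋀ A φ)    ¬s = let a , ¬t = ¬∀⇒∃¬ em ¬s in a , dual-complete em (φ a) ¬t
  dual-complete em (⋁ A φ)    ¬s = λ a → dual-complete em (φ a) λ t → ¬s (a , t)

module _ {L : Language ℓ} (em : ExcludedMiddle ℓ) {X Y : Structure L} where

  -- If `φ` failed in `X`, its dual would hold in `X`, hence in `Y`, contradicting `φ` there. Thus
  -- preservation of `dual φ` one way yields preservation of `φ` the other way.
  dual-reflects : (φ : Sentence L) → (X ⊨ dual φ → Y ⊨ dual φ) → Y ⊨ φ → X ⊨ φ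
  dual-reflects φ preserved s =
    decidable-stable em λ ¬s → dual-sound Y φ (preserved (dual-complete X em φ ¬s)) s

  ⊨Th⇒≡𝓟 : Y ⊨ᵀ Th (𝓟∞ω ∪ 𝓝∞ω) X → X ≡[ 𝓟∞ω ] Y
  ⊨Th⇒≡𝓟 Y⊨T φ φ∈𝓟 = mk⇔
    (λ s → Y⊨T φ (inj₁ φ∈𝓟 , s))
    (dual-reflects φ λ s → Y⊨T (dual φ) (inj₂ (dual-𝓟 φ∈𝓟) , s))

≡𝓟⇒⊨Th : ExcludedMiddle ℓ → {L : Language ℓ} {X Y : Structure L} →
         X ≡[ 𝓟∞ω ] Y → Y ⊨ᵀ Th (𝓟∞ω ∪ 𝓝∞ω) X
≡𝓟⇒⊨Th em X≡Y φ (inj₁ φ∈𝓟 , s) = Equivalence.to (X≡Y φ φ∈𝓟) s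
≡𝓟⇒⊨Th em X≡Y φ (inj₂ φ∈𝓝 , s) =
  dual-reflects em φ (Equivalence.from (X≡Y (dual φ) (dual-𝓝 φ∈𝓝))) s

-- Condensations preserve positive formulas

module _ {L : Language ℓ} {X Y : Structure L} (F : Condensation X Y) where
  open Condensation F
  open Bijection bijection using (to; injective; strictlySurjective)

  -- Injectivity of the condensation handles `neq`, surjectivity handles `all`, and `preserves`
  -- handles `rel`.
  condensation-𝓟 : {φ : Formula L n} → φ ∈ 𝓟∞ω → ∀ {ρ} → Sat X ρ φ → Sat Y (map to ρ) φ
  condensation-𝓟 (base (eq α β)) {ρ} s =
    trans (lookup-map α to ρ) (trans (cong to s) (sym (lookup-map β to ρ)))
  condensation-𝓟 (base (neq α β)) {ρ} s t =
    s (injective (trans (sym (lookup-map α to ρ)) (trans t (lookup-map β to ρ))))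
  condensation-𝓟 (base (rel i αs)) {ρ} s = subst (Rel Y i)
    (trans (sym (map-∘ to (lookup ρ) αs)) (map-cong (λ α → sym (lookup-map α to ρ)) αs))
    (preserves i _ s)
  condensation-𝓟 (all {φ = φ} p) {ρ} s y =
    let x , x↦y = strictlySurjective y
    in subst (λ z → Sat Y (z ∷ map to ρ) φ) x↦y (condensation-𝓟 p (s x))
  condensation-𝓟 (ex p)   (x , s) = to x , condensation-𝓟 p s
  condensation-𝓟 (conj p) s a     = condensation-𝓟 (p a) (s a)
  condensation-𝓟 (disj p) (a , s) = a , condensation-𝓟 (p a) s

∼c⇒≡𝓟 : {X Y : Structure L} → Y ∼c X → X ≡[ 𝓟∞ω ] Y
∼c⇒≡𝓟 (G , F) φ φ∈𝓟 = mk⇔ (condensation-𝓟 F φ∈𝓟) (condensation-𝓟 G φ∈𝓟)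

∼c-countable : {X Y : Structure L} → Y ∼c X → Countable X → Countable Y
∼c-countable (G , _) X↣ℕ = X↣ℕ ↣-∘ Bijection.injection (Condensation.bijection G)

-- The back-and-forth game

module Game {L : Language ℓ} (X Y : Structure L) where

  -- Winning strategies are trees rather than subsets of positions closed under
  -- moves: this keeps SpoilerWins in Set ℓ, where excluded middle applies.
  data SpoilerWins {n} (xs : Vec (Carrier X) n) (ys : Vec (Carrier Y) n) : Set ℓ where
    eq    : ∀ α β → lookup xs α ≡ lookup xs β → lookup ys α ≢ lookup ys β → SpoilerWins xs ys
    neq   : ∀ α β → lookup xs α ≢ lookup xs β → lookup ys α ≡ lookup ys β → SpoilerWins xs ys
    rel   : ∀ i αs → Rel X i (map (lookup xs) αs) → ¬ Rel Y i (map (lookup ys) αs) →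
            SpoilerWins xs ys
    forth : ∀ x → (∀ y → SpoilerWins (x ∷ xs) (y ∷ ys)) → SpoilerWins xs ys
    back  : ∀ y → (∀ x → SpoilerWins (x ∷ xs) (y ∷ ys)) → SpoilerWins xs ys

  -- After a move `forth x`, each reply `y` is excluded by its own formula; the conjunction of these
  -- over all `y` holds at `x` and at no `y`. After `back y`, each `x` satisfies its own disjunct,
  -- while `y` refutes all of them.
  separate : ∀ {n} {xs : Vec (Carrier X) n} {ys : Vec (Carrier Y) n} → SpoilerWins xs ys →
             Σ (Formula L n) λ φ → φ ∈ 𝓟∞ω × Sat X xs φ × ¬ Sat Y ys φ
  separate (eq α β s t)   = α ≐ β , base (eq α β) , s , t
  separate (neq α β s t)  = ¬̇ (α ≐ β) , base (neq α β) , s , λ ¬t → ¬t t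
  separate (rel i αs s t) = rel i αs , base (rel i αs) , s , t
  separate (forth x w)    =
    ∃̇ ⋀ (Carrier Y) (λ y → proj₁ (separate (w y))) ,
    ex (conj λ y → proj₁ (proj₂ (separate (w y)))) ,
    (x , λ y → proj₁ (proj₂ (proj₂ (separate (w y))))) ,
    λ (y , t) → proj₂ (proj₂ (proj₂ (separate (w y)))) (t y)
  separate (back y w)     =
    ∀̇ ⋁ (Carrier X) (λ x → proj₁ (separate (w x))) ,
    all (disj λ x → proj₁ (proj₂ (separate (w x)))) ,
    (λ x → x , proj₁ (proj₂ (proj₂ (separate (w x))))) ,
    λ t → let x , u = t y in proj₂ (proj₂ (proj₂ (separate (w x)))) u

  -- A run of the game along both enumerations

  module Run (em : ExcludedMiddle ℓ) (X↣ℕ : Countable X) (Y↣ℕ : Countable Y)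
             (start : ¬ SpoilerWins [] []) where

    record Position : Set ℓ where
      constructor position
      field
        {size} : ℕ
        xs     : Vec (Carrier X) size
        ys     : Vec (Carrier Y) size
        safe   : ¬ SpoilerWins xs ys

    record Paired (S : Position) (x : Carrier X) (y : Carrier Y) : Set ℓ where
      constructor paired
      open Position S
      field
        index : Fin size
        ≡x    : lookup xs index ≡ x
        ≡y    : lookup ys index ≡ y

    infix 4 _⊑_
    -- Inclusion of the finite relations listed by two positions, whatever the order and repetitions
    -- of their entries.
    _⊑_ : Position → Position → Set ℓ
    S ⊑ T = ∀ {x y} → Paired S x y → Paired T x y

    -- Two distinct partners of `x` would let Spoiler win at once by `eq`.
    functional : ∀ {S x y y′} → Paired S x y → Paired S x y′ → y ≡ y′
    functional {S} (paired α refl refl) (paired β x≡ refl) =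
      decidable-stable em λ y≢ → Position.safe S (eq α β (sym x≡) y≢)

    injective : ∀ {S x x′ y} → Paired S x y → Paired S x′ y → x ≡ x′
    injective {S} (paired α refl refl) (paired β refl y≡) =
      decidable-stable em λ x≢ → Position.safe S (neq α β x≢ (sym y≡))

    CoversX : Carrier X → Position → Set ℓ
    CoversX x S = ∃ λ y → Paired S x y

    CoversY : Carrier Y → Position → Set ℓ
    CoversY y S = ∃ λ x → Paired S x y

    push : ∀ {n} {xs : Vec (Carrier X) n} {ys : Vec (Carrier Y) n} x y
           {¬w} (¬w′ : ¬ SpoilerWins (x ∷ xs) (y ∷ ys)) →
           position xs ys ¬w ⊑ position (x ∷ xs) (y ∷ ys) ¬w′
    push x y ¬w′ (paired α p q) = paired (suc α) p q

    answerX : ∀ x S → Σ Position λ T → S ⊑ T × CoversX x T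
    answerX x (position xs ys ¬w) =
      -- If every reply lost, `forth x` would be a winning move for Spoiler, so some reply is safe.
      let y , ¬w′ = ¬∀⇒∃¬ em (¬w ∘ forth x)
      in position (x ∷ xs) (y ∷ ys) ¬w′ , push x y ¬w′ , y , paired zero refl refl

    answerY : ∀ y S → Σ Position λ T → S ⊑ T × CoversY y T
    answerY y (position xs ys ¬w) =
      let x , ¬w′ = ¬∀⇒∃¬ em (¬w ∘ back y)
      in position (x ∷ xs) (y ∷ ys) ¬w′ , push x y ¬w′ , x , paired zero refl refl

    answerCode : {Z : Set ℓ} (Z↣ℕ : Z ↣ ℕ) (C : Z → Position → Set ℓ) →
                 (∀ z S → Σ Position λ T → S ⊑ T × C z T) →
                 ∀ k S → Σ Position λ T → S ⊑ T × (∀ z → Injection.to Z↣ℕ z ≡ k → C z T)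
    answerCode {Z} Z↣ℕ C answer k S with em {Σ Z λ z → Injection.to Z↣ℕ z ≡ k}
    -- Countability is an injection into `ℕ`, so a code may belong to no element; the position then
    -- stays as it is.
    ... | no ∄z          = S , id , λ z p → ⊥-elim (∄z (z , p))
    ... | yes (z₀ , p₀)  =
      let T , S⊑T , c = answer z₀ S
      in T , S⊑T , λ z p → subst (λ z → C z T) (Injection.injective Z↣ℕ (trans p₀ (sym p))) c

    roundX : ∀ k S → Σ Position λ T → S ⊑ T × (∀ x → Injection.to X↣ℕ x ≡ k → CoversX x T)
    roundX = answerCode X↣ℕ CoversX answerX

    roundY : ∀ k S → Σ Position λ T → S ⊑ T × (∀ y → Injection.to Y↣ℕ y ≡ k → CoversY y T)
    roundY = answerCode Y↣ℕ CoversY answerY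

    play : ℕ → Position
    play zero    = position [] [] start
    -- The elements of code `k`, first in `X` and then in `Y`, are treated between stages `k` and
    -- `suc k`.
    play (suc k) = proj₁ (roundY k (proj₁ (roundX k (play k))))

    play-suc : ∀ k → play k ⊑ play (suc k)
    play-suc k = proj₁ (proj₂ (roundY k _)) ∘ proj₁ (proj₂ (roundX k (play k)))

    play-mono′ : ∀ {j k} → j ≤′ k → play j ⊑ play k
    play-mono′ ≤′-refl         = id
    play-mono′ (≤′-step {k} p) = play-suc k ∘ play-mono′ p

    play-mono : ∀ {j k} → j ≤ k → play j ⊑ play k
    play-mono j≤k = play-mono′ (≤⇒≤′ j≤k)

    -- The limit of the run is a condensation

    infix 4 _⟷_
    _⟷_ : Carrier X → Carrier Y → Set ℓ
    x ⟷ y = ∃ λ k → Paired (play k) x y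

    ⟷-functional : ∀ {x y y′} → x ⟷ y → x ⟷ y′ → y ≡ y′
    ⟷-functional (j , p) (k , q) =
      functional (play-mono (m≤m⊔n j k) p) (play-mono (m≤n⊔m j k) q)

    ⟷-injective : ∀ {x x′ y} → x ⟷ y → x′ ⟷ y → x ≡ x′
    ⟷-injective (j , p) (k , q) =
      injective (play-mono (m≤m⊔n j k) p) (play-mono (m≤n⊔m j k) q)

    ⟷-total : ∀ x → ∃ λ y → x ⟷ y
    ⟷-total x =
      let k     = Injection.to X↣ℕ x
          y , p = proj₂ (proj₂ (roundX k (play k))) x refl
      in y , suc k , proj₁ (proj₂ (roundY k _)) p

    ⟷-surjective : ∀ y → ∃ λ x → x ⟷ y
    ⟷-surjective y =
      let k     = Injection.to Y↣ℕ y
          x , p = proj₂ (proj₂ (roundY k _)) y refl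
      in x , suc k , p

    limit : Carrier X → Carrier Y
    limit = proj₁ ∘ ⟷-total

    limit-⟷ : ∀ x → x ⟷ limit x
    limit-⟷ = proj₂ ∘ ⟷-total

    limit-bijection : Carrier X ⤖ Carrier Y
    limit-bijection = mk⤖
      ( (λ {x} {x′} p → ⟷-injective (limit-⟷ x) (subst (x′ ⟷_) (sym p) (limit-⟷ x′)))
      , λ y → let x , r = ⟷-surjective y in x , λ { refl → ⟷-functional (limit-⟷ x) r } )

    -- A tuple is finite and the stages increase, so the maximum of the stages of its entries serves
    -- for all of them.
    paired-by-stage : ∀ {n} (xs : Vec (Carrier X) n) →
                      ∃ λ k → All (λ x → Paired (play k) x (limit x)) xs
    paired-by-stage []       = 0 , []
    paired-by-stage (x ∷ xs) =
      let j , p  = limit-⟷ x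
          k , ps = paired-by-stage xs
      in j ⊔ k , play-mono (m≤m⊔n j k) p ∷ All.map (play-mono (m≤n⊔m j k)) ps

    -- Presents a tuple and its image as the values of one tuple of variables at a position, the
    -- form that Spoiler's `rel` win requires.
    indices : ∀ {S n} {f : Carrier X → Carrier Y} {xs : Vec (Carrier X) n} →
              All (λ x → Paired S x (f x)) xs →
              ∃ λ αs → map (lookup (Position.xs S)) αs ≡ xs ×
                       map (lookup (Position.ys S)) αs ≡ map f xs
    indices []                   = [] , refl , refl
    indices (paired α p q ∷ ps) =
      let αs , ps′ , qs′ = indices ps in α ∷ αs , cong₂ _∷_ p ps′ , cong₂ _∷_ q qs′

    limit-preserves : ∀ i xs → Rel X i xs → Rel Y i (map limit xs)
    limit-preserves i xs r =
      let k , ps      = paired-by-stage xs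
          αs , ≡xs , ≡ys = indices ps
      in subst (Rel Y i) ≡ys (decidable-stable em λ ¬r →
           Position.safe (play k) (rel i αs (subst (Rel X i) (sym ≡xs) r) ¬r))

    condensation : Condensation X Y
    condensation = record { bijection = limit-bijection ; preserves = limit-preserves }

-- From positive sentences to condensations, and the equivalences

𝓟-transfer⇒condensation : ExcludedMiddle ℓ → {L : Language ℓ} {X Y : Structure L} →
                          Countable X → Countable Y →
                          (∀ φ → φ ∈ 𝓟∞ω → X ⊨ φ → Y ⊨ φ) → Condensation X Y
𝓟-transfer⇒condensation em {X = X} {Y} X↣ℕ Y↣ℕ transfer = Run.condensation em X↣ℕ Y↣ℕ
  -- At the empty position the separating formula is a sentence true in `X` and false in `Y`,
  -- against `transfer`.
  λ w → let φ , φ∈𝓟 , s , ¬t = separate w in ¬t (transfer φ φ∈𝓟 s)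
  where open Game X Y

≡𝓟⇒∼c : ExcludedMiddle ℓ → {L : Language ℓ} {X Y : Structure L} →
        Countable X → Countable Y → X ≡[ 𝓟∞ω ] Y → Y ∼c X
≡𝓟⇒∼c em X↣ℕ Y↣ℕ X≡Y =
  𝓟-transfer⇒condensation em Y↣ℕ X↣ℕ (λ φ p → Equivalence.from (X≡Y φ p)) ,
  𝓟-transfer⇒condensation em X↣ℕ Y↣ℕ (λ φ p → Equivalence.to (X≡Y φ p))

theorem4p3 : {ℓ : Level} → ExcludedMiddle ℓ →
    (L : Language ℓ) (X : Structure L) → Countable X →
    (WeaklyReversible X ⇔ ((Y : Structure L) → Countable Y → X ≡[ 𝓟∞ω ] Y → Y ≅ X))
    × (((Y : Structure L) → Countable Y → X ≡[ 𝓟∞ω ] Y → Y ≅ X)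
    ⇔ ω-CategoricalAt X (Th (𝓟∞ω ∪ 𝓝∞ω) X))
theorem4p3 em L X X↣ℕ =
  mk⇔ (λ wr Y Y↣ℕ X≡Y → wr Y (≡𝓟⇒∼c em X↣ℕ Y↣ℕ X≡Y))
      -- Weak reversibility ranges over all `Y`, but a bijection with `X` makes `Y` countable.
      (λ b Y Y∼X → b Y (∼c-countable Y∼X X↣ℕ) (∼c⇒≡𝓟 Y∼X)) ,
  mk⇔ (λ b Y Y↣ℕ Y⊨T → b Y Y↣ℕ (⊨Th⇒≡𝓟 em Y⊨T))
      (λ c Y Y↣ℕ X≡Y → c Y Y↣ℕ (≡𝓟⇒⊨Th em X≡Y))
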